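{- A class $\mathcal{C}$ of graphs is of bounded fusion-width (that is, there is a constant $c$ with $\mathrm{fw}(G)\le c$ for all $G\in\mathcal{C}$) if and only if it is of bounded clique-width (that is, there is a constant $c'$ with $\mathrm{cw}(G)\le c'$ for all $G\in\mathcal{C}$).
   Context: Graphs are finite, simple, undirected and nonempty. A $k$-expression is an expression built from atoms $i(v)$, unary operations $\eta_{i,j}$ and $\rho_{i\to j}$, and the binary operation $\oplus$, with labels $i,j\in\{1,\dots,k\}$, where: $i(v)$ creates a single vertex $v$ with label $i$; $\eta_{i,j}$ (for $i\neq j$) creates an edge between every vertex with label $i$ and every vertex with label $j$; $\rho_{i\to j}$ changes all labels $i$ to $j$; $\oplus$ forms the disjoint union of two labeled graphs. The generated graph is obtained by finally deleting the labels. The clique-width $\mathrm{cw}(G)$ is the smallest $k$ such that $G$ is generated by a $k$-expression. A $k$-fusion-tree expression is an expression built from atoms $i\langle m\rangle$, unary operations $\eta_{i,j}$, $\rho_{i\to j}$, $\theta_i$, and the binary operation $\oplus$, with labels $i,j\in\{1,\dots,k\}$, where: $i\langle m\rangle$ creates a graph consisting of $m$ isolated vertices labeled $i$; $\eta_{i,j}$ (for $i\ne j$) creates an edge between every vertex with label $i$ and every vertex with label $j$; $\rho_{i\to j}$ changes all labels $i$ to $j$; $\oplus$ forms the disjoint union of two labeled graphs; $\theta_i$ merges all vertices labeled $i$ into one vertex, which is labeled $i$ and is adjacent to every vertex not labeled $i$ to which some vertex labeled $i$ was adjacent before the operation. The generated graph is obtained by finally deleting all labels. The fusion-width $\mathrm{fw}(G)$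 is the smallest $k$ such that there is a $k$-fusion-tree expression generating $G$. -}

module Defs where

open import Data.Nat.Base using (ℕ; zero; suc; _≤_; NonZero)
open import Data.Nat.Properties using (≮⇒≥)
open import Data.Nat.Induction using (<-rec)
open import Data.Fin.Base using (Fin; zero; suc)
open import Data.Fin.Properties using (_≟_; +↔⊎)
open import Data.Bool.Base using (if_then_else_)
open import Data.List.Base using (List; []; _∷_; allFin; cartesianProduct)
open import Data.List.Membership.Propositional using (_∈_)
open import Data.List.Membership.Propositional.Properties
  using (∈-allFin; ∈-cartesianProduct⁺)
open import Data.List.Relation.Unary.Any using (here; there)
open import Data.Product.Base using (∃; _×_; _,_)
open import Data.Sum.Base using (_⊎_; inj₁; inj₂; [_,_]′)
open import Data.Sum.Function.Propositional using (_⊎-↔_)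
open import Data.Sum.Relation.Binary.Pointwise as Sum using (Pointwise)
open import Data.Empty using (⊥; ⊥-elim)
open import Function.Base using (id; _∘_)
open import Function.Bundles using (_↔_; _⇔_; Inverse; mk⇔)
open import Function.Construct.Composition using (_↔-∘_)
open import Function.Construct.Identity using (↔-id)
open import Function.Construct.Symmetry using (↔-sym)
open import Level using (Level; 0ℓ; _⊔_) renaming (suc to lsuc)
open import Relation.Binary.Core using (Rel)
open import Relation.Binary.Definitions
  using (Decidable; Symmetric; Irreflexive)
open import Relation.Binary.PropositionalEquality
  using (_≡_; _≢_; refl; sym; cong; subst₂)
open import Relation.Nullary using (¬_; yes; no; does)
open import Relation.Unary using (Pred)

private
  variable
    k : ℕ
    ℓ : Level

record Graph : Set₁ where
  infix 4 _~_ _~?_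
  field
    order        : ℕ
    {{nonEmpty}} : NonZero order
    _~_          : Rel (Fin order) 0ℓ
    _~?_         : Decidable _~_
    ~-sym        : Symmetric _~_
    ~-irrefl     : Irreflexive _≡_ _~_

-- The values of subexpressions. Finiteness, symmetry and irreflexivity are
-- not fields: every graph built by the operations below has them.
record LabeledGraph (k : ℕ) : Set₁ where
  field
    V   : Set
    Adj : Rel V 0ℓ
    lab : V → Fin k

open LabeledGraph

isolated : Fin k → ℕ → LabeledGraph k
isolated i m = record
  { V   = Fin m
  ; Adj = λ _ _ → ⊥
  ; lab = λ _ → i
  }

connect : Fin k → Fin k → LabeledGraph k → LabeledGraph k
connect i j H = record
  { V   = V H
  ; Adj = λ x y → Adj H x y
                ⊎ (lab H x ≡ i × lab H y ≡ j)
                ⊎ (lab H x ≡ j × lab H y ≡ i)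
  ; lab = lab H
  }

relabel : Fin k → Fin k → LabeledGraph k → LabeledGraph k
relabel i j H = record
  { V   = V H
  ; Adj = Adj H
  ; lab = λ x → if does (lab H x ≟ i) then j else lab H x
  }

disjointUnion : LabeledGraph k → LabeledGraph k → LabeledGraph k
disjointUnion H K = record
  { V   = V H ⊎ V K
  ; Adj = Pointwise (Adj H) (Adj K)
  ; lab = [ lab H , lab K ]′
  }

-- The irrelevant arguments make `merged` a single vertex, which is present
-- exactly when some vertex is labeled i; without one, merging changes nothing.
data MergedVertex (H : LabeledGraph k) (i : Fin k) : Set where
  kept   : (x : V H) → .(lab H x ≢ i) → MergedVertex H i
  merged : .(∃ λ x → lab H x ≡ i) → MergedVertex H i

module _ (H : LabeledGraph k) (i : Fin k) where

  mergedAdj : Rel (MergedVertex H i) 0ℓ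
  mergedAdj (kept x _) (kept y _) = Adj H x y
  mergedAdj (kept x _) (merged _) = ∃ λ z → lab H z ≡ i × Adj H x z
  mergedAdj (merged _) (kept y _) = ∃ λ z → lab H z ≡ i × Adj H z y
  mergedAdj (merged _) (merged _) = ⊥

  mergedLab : MergedVertex H i → Fin k
  mergedLab (kept x _) = lab H x
  mergedLab (merged _) = i

merge : Fin k → LabeledGraph k → LabeledGraph k
merge i H = record
  { V   = MergedVertex H i
  ; Adj = mergedAdj H i
  ; lab = mergedLab H i
  }

-- The name v in an atom i(v) is immaterial: graphs are compared up to
-- isomorphism, and every atom contributes a new vertex.
data CliqueExpr (k : ℕ) : Set where
  atom : (i : Fin k) → CliqueExpr k
  η    : (i j : Fin k) → i ≢ j → CliqueExpr k → CliqueExpr k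
  ρ    : (i j : Fin k) → CliqueExpr k → CliqueExpr k
  _⊕_  : CliqueExpr k → CliqueExpr k → CliqueExpr k

-- Graphs are nonempty, so an atom i⟨m⟩ has m ≥ 1.
data FusionExpr (k : ℕ) : Set where
  atom : (i : Fin k) (m : ℕ) → .{{NonZero m}} → FusionExpr k
  η    : (i j : Fin k) → i ≢ j → FusionExpr k → FusionExpr k
  ρ    : (i j : Fin k) → FusionExpr k → FusionExpr k
  θ    : (i : Fin k) → FusionExpr k → FusionExpr k
  _⊕_  : FusionExpr k → FusionExpr k → FusionExpr k

⟦_⟧ᶜ : CliqueExpr k → LabeledGraph k
⟦ atom i    ⟧ᶜ = isolated i 1
⟦ η i j _ e ⟧ᶜ = connect i j ⟦ e ⟧ᶜ
⟦ ρ i j e   ⟧ᶜ = relabel i j ⟦ e ⟧ᶜ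
⟦ e ⊕ f     ⟧ᶜ = disjointUnion ⟦ e ⟧ᶜ ⟦ f ⟧ᶜ

⟦_⟧ᶠ : FusionExpr k → LabeledGraph k
⟦ atom i m  ⟧ᶠ = isolated i m
⟦ η i j _ e ⟧ᶠ = connect i j ⟦ e ⟧ᶠ
⟦ ρ i j e   ⟧ᶠ = relabel i j ⟦ e ⟧ᶠ
⟦ θ i e     ⟧ᶠ = merge i ⟦ e ⟧ᶠ
⟦ e ⊕ f     ⟧ᶠ = disjointUnion ⟦ e ⟧ᶠ ⟦ f ⟧ᶠ

-- H is isomorphic to G once its labels are deleted.
record _≅_ (H : LabeledGraph k) (G : Graph) : Set where
  open Graph G
  field
    bij : V H ↔ Fin order
    adj : ∀ x y → Adj H x y ⇔ (Inverse.to bij x ~ Inverse.to bij y)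

CliqueGenerated : Graph → ℕ → Set
CliqueGenerated G k = ∃ λ (e : CliqueExpr k) → ⟦ e ⟧ᶜ ≅ G

FusionGenerated : Graph → ℕ → Set
FusionGenerated G k = ∃ λ (e : FusionExpr k) → ⟦ e ⟧ᶠ ≅ G

IsLeast : Pred ℕ ℓ → Pred ℕ ℓ
IsLeast P k = P k × (∀ m → P m → k ≤ m)

IsCliqueWidth : Graph → ℕ → Set
IsCliqueWidth G = IsLeast (CliqueGenerated G)

IsFusionWidth : Graph → ℕ → Set
IsFusionWidth G = IsLeast (FusionGenerated G)

-- A width is given by its graph (the relation W), since a least element of an
-- inhabited predicate on ℕ exists constructively only up to double negation
-- (¬¬cliqueWidth and ¬¬fusionWidth below). As k ≤ c is stable under double
-- negation, quantifying over every k that is the width loses nothing.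
BoundedWidth : (Graph → ℕ → Set) → Pred Graph ℓ → Set (lsuc 0ℓ ⊔ ℓ)
BoundedWidth W C = ∃ λ c → ∀ G → C G → ∀ k → W G k → k ≤ c

BoundedCliqueWidth : Pred Graph ℓ → Set (lsuc 0ℓ ⊔ ℓ)
BoundedCliqueWidth = BoundedWidth IsCliqueWidth

BoundedFusionWidth : Pred Graph ℓ → Set (lsuc 0ℓ ⊔ ℓ)
BoundedFusionWidth = BoundedWidth IsFusionWidth

¬¬least : {P : Pred ℕ ℓ} → ∀ n → P n → ¬ ¬ ∃ (IsLeast P)
¬¬least {P = P} = <-rec (λ n → P n → ¬ ¬ ∃ (IsLeast P)) λ n rec Pn ¬least →
  ¬least (n , Pn , λ m Pm → ≮⇒≥ λ m<n → rec m<n Pm ¬least)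

-- Every graph is generated by an expression with one label per vertex.

private
  atoms : ∀ n → (Fin (suc n) → Fin k) → CliqueExpr k
  atoms zero    f = atom (f zero)
  atoms (suc n) f = atom (f zero) ⊕ atoms n (f ∘ suc)

  atoms-V : ∀ n (f : Fin (suc n) → Fin k) → V ⟦ atoms n f ⟧ᶜ ↔ Fin (suc n)
  atoms-V zero    f = ↔-id _
  atoms-V (suc n) f = ↔-sym (+↔⊎ {1} {suc n}) ↔-∘ (↔-id _ ⊎-↔ atoms-V n (f ∘ suc))

  atoms-lab : ∀ n (f : Fin (suc n) → Fin k) x →
              lab ⟦ atoms n f ⟧ᶜ x ≡ f (Inverse.to (atoms-V n f) x)
  atoms-lab zero    f zero        = refl
  atoms-lab (suc n) f (inj₁ zero) = refl
  atoms-lab (suc n) f (inj₂ x)    = atoms-lab n (f ∘ suc) x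

  atoms-Adj : ∀ n (f : Fin (suc n) → Fin k) x y → ¬ Adj ⟦ atoms n f ⟧ᶜ x y
  atoms-Adj (suc n) f _ _ (Sum.inj₂ a) = atoms-Adj n (f ∘ suc) _ _ a

  module _ {n} (_~_ : Rel (Fin (suc n)) 0ℓ) (_~?_ : Decidable _~_)
           (~-sym : Symmetric _~_) (~-irrefl : Irreflexive _≡_ _~_) where

    edges : List (Fin (suc n) × Fin (suc n)) → CliqueExpr (suc n)
    edges []             = atoms n id
    edges ((i , j) ∷ ps) with i ~? j
    ... | yes i~j = η i j (λ i≡j → ~-irrefl i≡j i~j) (edges ps)
    ... | no  _   = edges ps

    edges-V : ∀ ps → V ⟦ edges ps ⟧ᶜ ↔ Fin (suc n)
    edges-V []             = atoms-V n id
    edges-V ((i , j) ∷ ps) with i ~? j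
    ... | yes _ = edges-V ps
    ... | no  _ = edges-V ps

    edges-lab : ∀ ps x → lab ⟦ edges ps ⟧ᶜ x ≡ Inverse.to (edges-V ps) x
    edges-lab []             = atoms-lab n id
    edges-lab ((i , j) ∷ ps) with i ~? j
    ... | yes _ = edges-lab ps
    ... | no  _ = edges-lab ps

    edges-sound : ∀ ps x y → Adj ⟦ edges ps ⟧ᶜ x y →
                  lab ⟦ edges ps ⟧ᶜ x ~ lab ⟦ edges ps ⟧ᶜ y
    edges-sound []             x y a = ⊥-elim (atoms-Adj n id x y a)
    edges-sound ((i , j) ∷ ps) x y a with i ~? j
    edges-sound (_ ∷ ps) x y (inj₁ a)                 | yes _   = edges-sound ps x y a
    edges-sound (_ ∷ ps) x y (inj₂ (inj₁ (p , q))) | yes i~j =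
      subst₂ _~_ (sym p) (sym q) i~j
    edges-sound (_ ∷ ps) x y (inj₂ (inj₂ (p , q))) | yes i~j =
      subst₂ _~_ (sym p) (sym q) (~-sym i~j)
    edges-sound (_ ∷ ps) x y a                        | no _    = edges-sound ps x y a

    edges-complete : ∀ ps x y → (lab ⟦ edges ps ⟧ᶜ x , lab ⟦ edges ps ⟧ᶜ y) ∈ ps →
                     lab ⟦ edges ps ⟧ᶜ x ~ lab ⟦ edges ps ⟧ᶜ y →
                     Adj ⟦ edges ps ⟧ᶜ x y
    edges-complete ((i , j) ∷ ps) x y p∈ l~l with i ~? j
    edges-complete (_ ∷ ps) x y (here refl) l~l | yes _   = inj₂ (inj₁ (refl , refl))
    edges-complete (_ ∷ ps) x y (there p∈)  l~l | yes _   =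
      inj₁ (edges-complete ps x y p∈ l~l)
    edges-complete (_ ∷ ps) x y (here refl) l~l | no ¬i~j = ⊥-elim (¬i~j l~l)
    edges-complete (_ ∷ ps) x y (there p∈)  l~l | no _    = edges-complete ps x y p∈ l~l

cliqueGenerated : ∀ G → CliqueGenerated G (Graph.order G)
cliqueGenerated record { order = suc n ; _~_ = _~_ ; _~?_ = _~?_
                       ; ~-sym = ~-sym ; ~-irrefl = ~-irrefl } =
  edges′ ps , record
    { bij = V′
    ; adj = λ x y → mk⇔
        (λ a → subst₂ _~_ (lab′ x) (lab′ y)
                 (edges-sound _~_ _~?_ ~-sym ~-irrefl ps x y a))
        (λ t → edges-complete _~_ _~?_ ~-sym ~-irrefl ps x y
                 (∈-cartesianProduct⁺ (∈-allFin _) (∈-allFin _))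
                 (subst₂ _~_ (sym (lab′ x)) (sym (lab′ y)) t))
    }
  where
  ps     = cartesianProduct (allFin (suc n)) (allFin (suc n))
  edges′ = edges _~_ _~?_ ~-sym ~-irrefl
  V′     = edges-V _~_ _~?_ ~-sym ~-irrefl ps
  lab′   = edges-lab _~_ _~?_ ~-sym ~-irrefl ps

cliqueToFusion : CliqueExpr k → FusionExpr k
cliqueToFusion (atom i)    = atom i 1
cliqueToFusion (η i j p e) = η i j p (cliqueToFusion e)
cliqueToFusion (ρ i j e)   = ρ i j (cliqueToFusion e)
cliqueToFusion (e ⊕ f)     = cliqueToFusion e ⊕ cliqueToFusion f

⟦cliqueToFusion⟧ : (e : CliqueExpr k) → ⟦ cliqueToFusion e ⟧ᶠ ≡ ⟦ e ⟧ᶜ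
⟦cliqueToFusion⟧ (atom i)    = refl
⟦cliqueToFusion⟧ (η i j p e) = cong (connect i j) (⟦cliqueToFusion⟧ e)
⟦cliqueToFusion⟧ (ρ i j e)   = cong (relabel i j) (⟦cliqueToFusion⟧ e)
⟦cliqueToFusion⟧ (e ⊕ f)
  rewrite ⟦cliqueToFusion⟧ e | ⟦cliqueToFusion⟧ f = refl

fusionGenerated : ∀ G → FusionGenerated G (Graph.order G)
fusionGenerated G with cliqueGenerated G
... | e , iso rewrite sym (⟦cliqueToFusion⟧ e) = cliqueToFusion e , iso

¬¬cliqueWidth : ∀ G → ¬ ¬ ∃ (IsCliqueWidth G)
¬¬cliqueWidth G = ¬¬least _ (cliqueGenerated G)

¬¬fusionWidth : ∀ G → ¬ ¬ ∃ (IsFusionWidth G)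
¬¬fusionWidth G = ¬¬least _ (fusionGenerated G)

{-# OPTIONS --safe #-}

-- The fate of a label class at a node of a fusion-tree expression is decided
-- by the operations above the node: either all its vertices are later merged
-- by some θ, and the class is called doomed, or none is. The clique expression
-- creates only the vertices that are not doomed. In place of the doomed ones,
-- the label of a vertex records, next to its label in the fusion-tree
-- expression, the set of doomed labels in its neighbourhood. When θ i merges a
-- class that is not doomed any more, the merged vertex is added as a new atom
-- and connected to the vertices whose recorded set contains i. Hence a graph
-- of fusion-width k has clique-width at most k * 2 ^ k.
module Submission where

open import Defs
open import Data.Bool.Base using (if_then_else_)
open import Data.Empty using (⊥; ⊥-elim; ⊥-elim-irr)
open import Data.Fin.Base using (Fin; zero; suc; combine; remQuot; finToFun; funToFin; fromℕ<)
open import Data.Fin.Properties using (_≟_; any?; +↔⊎; remQuot-combine; finToFun-funToFin)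
open import Data.List.Base using (List; []; _∷_; allFin; cartesianProduct)
open import Data.List.Membership.Propositional using (_∈_)
open import Data.List.Membership.Propositional.Properties using (∈-allFin; ∈-cartesianProduct⁺)
open import Data.List.Relation.Unary.Any using (here; there)
open import Data.Nat.Base using (ℕ; zero; suc; _*_; _^_; _≤_; >-nonZero⁻¹)
open import Data.Nat.Properties using (_≤?_; ≤-trans; *-mono-≤; ^-monoʳ-≤)
open import Data.Product.Base using (∃; _×_; _,_; proj₁; proj₂)
open import Data.Sum.Base as Sum using (_⊎_; inj₁; inj₂; [_,_]′)
open import Data.Sum.Function.Propositional using (_⊎-↔_)
import Data.Sum.Relation.Binary.Pointwise as Pointwise
open import Function.Base using (id; _∘_)
open import Function.Bundles using (_↔_; _⇔_; Inverse; Equivalence; mk⇔; mk↔ₛ′)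
open import Function.Construct.Composition using (_↔-∘_; _⇔-∘_)
open import Function.Construct.Identity using (↔-id; ⇔-id)
open import Function.Construct.Symmetry using (↔-sym)
open import Level using (Level; 0ℓ)
open import Relation.Binary.Core using (Rel)
open import Relation.Binary.Definitions using (Decidable)
open import Relation.Binary.PropositionalEquality using (_≡_; _≢_; refl; sym; trans; cong; cong₂; subst)
open import Relation.Nullary using (¬_; Dec; yes; no; does; contradiction; recompute)
open import Relation.Nullary.Decidable using (map′; _×-dec_; _⊎-dec_; ¬?; decidable-stable)
open import Relation.Unary using (Pred)
import Relation.Unary as Unary

open LabeledGraph
open Equivalence using () renaming (to to ⇒; from to ⇐)

private
  variable
    k M : ℕ

-- Labeled isomorphism and the graphs built by clique expressions.

infix 4 _≃_

record _≃_ (H K : LabeledGraph M) : Set where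
  field
    bij : V H ↔ V K
    adj : ∀ x y → Adj H x y ⇔ Adj K (Inverse.to bij x) (Inverse.to bij y)
    labels : ∀ x → lab H x ≡ lab K (Inverse.to bij x)

≃-trans : {H K L : LabeledGraph M} → H ≃ K → K ≃ L → H ≃ L
≃-trans p q = record
  { bij = Q.bij ↔-∘ P.bij
  ; adj = λ x y → Q.adj _ _ ⇔-∘ P.adj x y
  ; labels = λ x → trans (P.labels x) (Q.labels _)
  }
  where
  module P = _≃_ p
  module Q = _≃_ q

CliqueBuilt : LabeledGraph M → Set
CliqueBuilt {M} H = ∃ λ (e : CliqueExpr M) → ⟦ e ⟧ᶜ ≃ H

cliqueBuilt-resp : {H K : LabeledGraph M} → H ≃ K → CliqueBuilt H → CliqueBuilt K
cliqueBuilt-resp H≃K (e , iso) = e , ≃-trans iso H≃K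

connect-built : {H : LabeledGraph M} (i j : Fin M) → i ≢ j →
                CliqueBuilt H → CliqueBuilt (connect i j H)
connect-built {H = H} i j i≢j (e , iso) = η i j i≢j e , record
  { bij = bij
  ; adj = λ x y → mk⇔
      (λ { (inj₁ a) → inj₁ (⇒ (adj x y) a)
         ; (inj₂ (inj₁ (p , q))) → inj₂ (inj₁ (trans (sym (labels x)) p , trans (sym (labels y)) q))
         ; (inj₂ (inj₂ (p , q))) → inj₂ (inj₂ (trans (sym (labels x)) p , trans (sym (labels y)) q)) })
      (λ { (inj₁ a) → inj₁ (⇐ (adj x y) a)
         ; (inj₂ (inj₁ (p , q))) → inj₂ (inj₁ (trans (labels x) p , trans (labels y) q))
         ; (inj₂ (inj₂ (p , q))) → inj₂ (inj₂ (trans (labels x) p , trans (labels y) q)) })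
  ; labels = labels
  }
  where open _≃_ iso

relabel-built : {H : LabeledGraph M} (i j : Fin M) → CliqueBuilt H → CliqueBuilt (relabel i j H)
relabel-built i j (e , iso) = ρ i j e , record
  { bij = bij
  ; adj = adj
  ; labels = λ x → cong (λ l → if does (l ≟ i) then j else l) (labels x)
  }
  where open _≃_ iso

disjointUnion-built : {H K : LabeledGraph M} →
                      CliqueBuilt H → CliqueBuilt K → CliqueBuilt (disjointUnion H K)
disjointUnion-built (e , p) (f , q) = e ⊕ f , record
  { bij = P.bij ⊎-↔ Q.bij
  ; adj = λ
      { (inj₁ x) (inj₁ y) → mk⇔ (λ { (Pointwise.inj₁ a) → Pointwise.inj₁ (⇒ (P.adj x y) a) })
                                (λ { (Pointwise.inj₁ a) → Pointwise.inj₁ (⇐ (P.adj x y) a) })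
      ; (inj₁ x) (inj₂ y) → mk⇔ (λ ()) (λ ())
      ; (inj₂ x) (inj₁ y) → mk⇔ (λ ()) (λ ())
      ; (inj₂ x) (inj₂ y) → mk⇔ (λ { (Pointwise.inj₂ a) → Pointwise.inj₂ (⇒ (Q.adj x y) a) })
                                (λ { (Pointwise.inj₂ a) → Pointwise.inj₂ (⇐ (Q.adj x y) a) })
      }
  ; labels = λ { (inj₁ x) → P.labels x ; (inj₂ y) → Q.labels y }
  }
  where
  module P = _≃_ p
  module Q = _≃_ q

atom-built : (i : Fin M) → CliqueBuilt (isolated i 1)
atom-built i = atom i , record { bij = ↔-id _ ; adj = λ _ _ → ⇔-id _ ; labels = λ _ → refl }

isolated-built : (i : Fin M) (n : ℕ) → CliqueBuilt (isolated i (suc n))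
isolated-built i zero    = atom-built i
isolated-built i (suc n) =
  cliqueBuilt-resp iso (disjointUnion-built (atom-built i) (isolated-built i n))
  where
  iso : disjointUnion (isolated i 1) (isolated i (suc n)) ≃ isolated i (suc (suc n))
  iso = record
    { bij = ↔-sym (+↔⊎ {1} {suc n})
    ; adj = λ _ _ → mk⇔ (λ { (Pointwise.inj₁ ()) ; (Pointwise.inj₂ ()) }) (λ ())
    ; labels = λ { (inj₁ _) → refl ; (inj₂ _) → refl }
    }

-- Simultaneous relabeling along an idempotent map.

mapLabels : (Fin M → Fin M) → LabeledGraph M → LabeledGraph M
mapLabels h H = record { V = V H ; Adj = Adj H ; lab = h ∘ lab H }

module Renaming {M : ℕ} (h : Fin M → Fin M) (h-idem : ∀ l → h (h l) ≡ h l) where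

  rename : List (Fin M) → Fin M → Fin M
  rename []       l = l
  rename (a ∷ as) l = if does (rename as l ≟ a) then h a else rename as l

  rename-built : {H : LabeledGraph M} → ∀ as → CliqueBuilt H → CliqueBuilt (mapLabels (rename as) H)
  rename-built []       b = b
  rename-built (a ∷ as) b = relabel-built a (h a) (rename-built as b)

  -- Idempotence makes the order of the substitutions a ↦ h a irrelevant: a
  -- label is replaced at most once to any effect.
  rename-step : ∀ as l → rename as l ≡ l ⊎ rename as l ≡ h l
  rename-step []       l = inj₁ refl
  rename-step (a ∷ as) l with rename as l ≟ a | rename-step as l
  ... | no _     | r         = r
  ... | yes refl | inj₁ r≡l  = inj₂ (cong h r≡l)
  ... | yes refl | inj₂ r≡hl = inj₂ (trans (cong h r≡hl) (h-idem l))

  -- The list is processed from its end. When the entry `l` is reached, the current label is `l` or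
  -- already `h l`, and in both cases it leaves as `h l`. A later substitution at `h l` yields
  -- `h (h l)`, which is `h l` again.
  rename-∈ : ∀ {as l} → l ∈ as → rename as l ≡ h l
  rename-∈ {a ∷ as} (here refl) with rename as a ≟ a | rename-step as a
  ... | yes _  | _      = refl
  ... | no r≢a | inj₁ r = contradiction r r≢a
  ... | no _   | inj₂ r = r
  rename-∈ {a ∷ as} {l} (there l∈as) with rename as l ≟ a | rename-∈ l∈as
  ... | no _     | r = r
  ... | yes refl | r = trans (cong h r) (h-idem l)

  mapLabels-built : {H : LabeledGraph M} → CliqueBuilt H → CliqueBuilt (mapLabels h H)
  mapLabels-built b = cliqueBuilt-resp
    (record { bij = ↔-id _ ; adj = λ _ _ → ⇔-id _ ; labels = λ _ → rename-∈ (∈-allFin _) })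
    (rename-built (allFin M) b)

open Renaming using (mapLabels-built)

-- Adding all edges prescribed by a relation on labels.

connectBy : Rel (Fin M) 0ℓ → LabeledGraph M → LabeledGraph M
connectBy Q H = record
  { V   = V H
  ; Adj = λ x y → Adj H x y ⊎ Q (lab H x) (lab H y) ⊎ Q (lab H y) (lab H x)
  ; lab = lab H
  }

module _ {M : ℕ} (Q : Rel (Fin M) 0ℓ) (Q? : Decidable Q) (Q-irrefl : ∀ l → ¬ Q l l) where

  -- Cutting `Q` down to the pairs of a list permits induction on the list, with one `η` for each
  -- listed pair in `Q`. The list of all pairs gives `Q` back.
  QIn : List (Fin M × Fin M) → Rel (Fin M) 0ℓ
  QIn ps l m = (l , m) ∈ ps × Q l m

  connectIn-built : {H : LabeledGraph M} → ∀ ps → CliqueBuilt H → CliqueBuilt (connectBy (QIn ps) H)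
  connectIn-built [] b = cliqueBuilt-resp
    (record { bij = ↔-id _
            ; adj = λ _ _ → mk⇔ inj₁ (λ { (inj₁ a) → a ; (inj₂ (inj₁ (() , _))) ; (inj₂ (inj₂ (() , _))) })
            ; labels = λ _ → refl }) b
  connectIn-built {H} ((l , m) ∷ ps) b with Q? l m
  ... | no ¬q = cliqueBuilt-resp
    (record { bij = ↔-id _
            ; adj = λ _ _ → mk⇔
                (λ { (inj₁ a) → inj₁ a
                   ; (inj₂ (inj₁ (p , q))) → inj₂ (inj₁ (there p , q))
                   ; (inj₂ (inj₂ (p , q))) → inj₂ (inj₂ (there p , q)) })
                (λ { (inj₁ a) → inj₁ a
                   ; (inj₂ (inj₁ (here refl , q))) → contradiction q ¬q
                   ; (inj₂ (inj₁ (there p , q))) → inj₂ (inj₁ (p , q))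
                   ; (inj₂ (inj₂ (here refl , q))) → contradiction q ¬q
                   ; (inj₂ (inj₂ (there p , q))) → inj₂ (inj₂ (p , q)) })
            ; labels = λ _ → refl })
    (connectIn-built ps b)
  ... | yes q = cliqueBuilt-resp
    (record { bij = ↔-id _
            ; adj = λ _ _ → mk⇔
                (λ { (inj₁ (inj₁ a)) → inj₁ a
                   ; (inj₁ (inj₂ (inj₁ (p , q)))) → inj₂ (inj₁ (there p , q))
                   ; (inj₁ (inj₂ (inj₂ (p , q)))) → inj₂ (inj₂ (there p , q))
                   ; (inj₂ (inj₁ (refl , refl))) → inj₂ (inj₁ (here refl , q))
                   ; (inj₂ (inj₂ (refl , refl))) → inj₂ (inj₂ (here refl , q)) })
                (λ { (inj₁ a) → inj₁ (inj₁ a)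
                   ; (inj₂ (inj₁ (here refl , q))) → inj₂ (inj₁ (refl , refl))
                   ; (inj₂ (inj₁ (there p , q))) → inj₁ (inj₂ (inj₁ (p , q)))
                   ; (inj₂ (inj₂ (here refl , q))) → inj₂ (inj₂ (refl , refl))
                   ; (inj₂ (inj₂ (there p , q))) → inj₁ (inj₂ (inj₂ (p , q))) })
            ; labels = λ _ → refl })
    -- `η` demands two distinct labels, which is what irreflexivity of `Q` provides.
    (connect-built l m (λ { refl → Q-irrefl l q }) (connectIn-built ps b))

  connectBy-built : {H : LabeledGraph M} → CliqueBuilt H → CliqueBuilt (connectBy Q H)
  connectBy-built b = cliqueBuilt-resp
    (record { bij = ↔-id _
            ; adj = λ _ _ → mk⇔
                (λ { (inj₁ a) → inj₁ a
                   ; (inj₂ (inj₁ (_ , q))) → inj₂ (inj₁ q)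
                   ; (inj₂ (inj₂ (_ , q))) → inj₂ (inj₂ q) })
                (λ { (inj₁ a) → inj₁ a
                   ; (inj₂ (inj₁ q)) → inj₂ (inj₁ (∈-pairs , q))
                   ; (inj₂ (inj₂ q)) → inj₂ (inj₂ (∈-pairs , q)) })
            ; labels = λ _ → refl })
    (connectIn-built (cartesianProduct (allFin M) (allFin M)) b)
    where
    ∈-pairs : ∀ {l m} → (l , m) ∈ cartesianProduct (allFin M) (allFin M)
    ∈-pairs = ∈-cartesianProduct⁺ (∈-allFin _) (∈-allFin _)

-- Clique expressions generate no empty graph, but the survivors of a
-- subexpression may be absent.
Constructible : LabeledGraph M → Set
Constructible H = ¬ V H ⊎ CliqueBuilt H

disjointUnion-constructible : {H K : LabeledGraph M} → Constructible H → Constructible K →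
                              Constructible (disjointUnion H K)
disjointUnion-constructible (inj₁ ¬x) (inj₁ ¬y) = inj₁ [ ¬x , ¬y ]′
disjointUnion-constructible (inj₁ ¬x) (inj₂ c)  = inj₂ (cliqueBuilt-resp
  (record { bij = mk↔ₛ′ inj₂ (λ { (inj₁ x) → contradiction x ¬x ; (inj₂ y) → y })
                        (λ { (inj₁ x) → contradiction x ¬x ; (inj₂ y) → refl }) (λ _ → refl)
          ; adj = λ _ _ → mk⇔ Pointwise.inj₂ (λ { (Pointwise.inj₂ a) → a })
          ; labels = λ _ → refl }) c)
disjointUnion-constructible (inj₂ b) (inj₁ ¬y)  = inj₂ (cliqueBuilt-resp
  (record { bij = mk↔ₛ′ inj₁ (λ { (inj₁ x) → x ; (inj₂ y) → contradiction y ¬y })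
                        (λ { (inj₁ x) → refl ; (inj₂ y) → contradiction y ¬y }) (λ _ → refl)
          ; adj = λ _ _ → mk⇔ Pointwise.inj₁ (λ { (Pointwise.inj₁ a) → a })
          ; labels = λ _ → refl }) b)
disjointUnion-constructible (inj₂ b) (inj₂ c)   = inj₂ (disjointUnion-built b c)

-- Neighbouring labels and their behaviour under merging.

HasLabel : LabeledGraph k → Pred (Fin k) 0ℓ
HasLabel H i = ∃ λ x → lab H x ≡ i

HasNbr : (H : LabeledGraph k) → V H → Pred (Fin k) 0ℓ
HasNbr H x j = ∃ λ z → lab H z ≡ j × Adj H x z

HasEdge : LabeledGraph k → Rel (Fin k) 0ℓ
HasEdge H i j = ∃ λ x → lab H x ≡ i × HasNbr H x j

module _ {k : ℕ} {H : LabeledGraph k} {i : Fin k} where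

  kept-cong : ∀ {x y} .{p : lab H x ≢ i} .{q : lab H y ≢ i} → x ≡ y → kept {H = H} x p ≡ kept y q
  kept-cong refl = refl

  -- A neighbour labeled `i` is swallowed by the merged vertex, which is again labeled `i` and
  -- adjacent to `x`. So a kept vertex sees the same labels before and after, including `i` itself.
  keptNbr : ∀ {x j} .{x≢i : lab H x ≢ i} →
            HasNbr H x j ⇔ HasNbr (merge i H) (kept x x≢i) j
  keptNbr {x} {j} {x≢i} = mk⇔ raise
    λ { (kept z _ , z≡j , a) → z , z≡j , a
      ; (merged _ , i≡j , z , z≡i , a) → z , trans z≡i i≡j , a }
    where
    raise : HasNbr H x j → HasNbr (merge i H) (kept x x≢i) j
    raise (z , z≡j , a) with lab H z ≟ i
    ... | yes z≡i = merged (z , z≡i) , trans (sym z≡i) z≡j , z , z≡i , a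
    ... | no z≢i  = kept z z≢i , z≡j , a

  -- The merged vertex inherits the edges of its whole class, so its neighbouring labels are read
  -- off `HasEdge`. The label `i` is excluded because edges inside the class vanish.
  mergedNbr : ∀ {j} .{x∈i : HasLabel H i} → j ≢ i →
              HasEdge H i j ⇔ HasNbr (merge i H) (merged x∈i) j
  mergedNbr j≢i = mk⇔
    (λ { (x , x≡i , z , refl , a) → kept z j≢i , refl , x , x≡i , a })
    (λ { (kept z _ , z≡j , x , x≡i , a) → x , x≡i , z , z≡j , a ; (merged _ , _ , ()) })

-- A recorded set describes edges from a surviving vertex to the merged class, while adjacency of
-- the merged vertex to a kept one is stated in the opposite direction. Symmetry translates between
-- the two.
Adj-sym : (e : FusionExpr k) → ∀ {x y} → Adj ⟦ e ⟧ᶠ x y → Adj ⟦ e ⟧ᶠ y x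
Adj-sym (η i j _ e) (inj₁ a)               = inj₁ (Adj-sym e a)
Adj-sym (η i j _ e) (inj₂ (inj₁ (p , q))) = inj₂ (inj₂ (q , p))
Adj-sym (η i j _ e) (inj₂ (inj₂ (p , q))) = inj₂ (inj₁ (q , p))
Adj-sym (ρ i j e)   a                      = Adj-sym e a
Adj-sym (θ i e) {kept _ _} {kept _ _} a            = Adj-sym e a
Adj-sym (θ i e) {kept _ _} {merged _} (z , z≡i , a) = z , z≡i , Adj-sym e a
Adj-sym (θ i e) {merged _} {kept _ _} (z , z≡i , a) = z , z≡i , Adj-sym e a
Adj-sym (e ⊕ f) (Pointwise.inj₁ a) = Pointwise.inj₁ (Adj-sym e a)
Adj-sym (e ⊕ f) (Pointwise.inj₂ a) = Pointwise.inj₂ (Adj-sym f a)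

-- Deciding which labels and which edges between labels occur.

replace : Fin k → Fin k → Fin k → Fin k
replace i j l = if does (l ≟ i) then j else l

replace-idem : ∀ (i j l : Fin k) → replace i j (replace i j l) ≡ replace i j l
replace-idem i j l with l ≟ i
... | yes _ with j ≟ i
...   | yes _ = refl
...   | no _  = refl
replace-idem i j l | no l≢i with l ≟ i
...   | yes l≡i = contradiction l≡i l≢i
...   | no _    = refl

-- The clique expression depends on whether a class is inhabited: only then does `θ` leave a merged
-- vertex or `η` create new neighbours. The decision goes by recursion on the expression.
hasLabel? : (e : FusionExpr k) → Unary.Decidable (HasLabel ⟦ e ⟧ᶠ)
hasLabel? (atom i (suc m)) a = map′ (zero ,_) proj₂ (i ≟ a)
hasLabel? (η i j _ e) a = hasLabel? e a
hasLabel? (ρ i j e) a =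
  map′ (λ { (_ , b↦a , x , refl) → x , b↦a }) (λ { (x , x↦a) → _ , x↦a , x , refl })
       (any? λ b → replace i j b ≟ a ×-dec hasLabel? e b)
hasLabel? (θ i e) a = map′ raise lower (hasLabel? e a)
  where
  raise : HasLabel ⟦ e ⟧ᶠ a → HasLabel ⟦ θ i e ⟧ᶠ a
  raise (x , x≡a) with lab ⟦ e ⟧ᶠ x ≟ i
  ... | yes x≡i = merged (x , x≡i) , trans (sym x≡i) x≡a
  ... | no x≢i  = kept x x≢i , x≡a
  lower : HasLabel ⟦ θ i e ⟧ᶠ a → HasLabel ⟦ e ⟧ᶠ a
  lower (kept x _ , x≡a)    = x , x≡a
  -- The witness inside `merged` is irrelevant, so a usable one is obtained by deciding the property
  -- anew.
  lower (merged x∈i , refl) = recompute (hasLabel? e i) x∈i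
hasLabel? (e ⊕ f) a =
  map′ [ (λ (x , p) → inj₁ x , p) , (λ (y , p) → inj₂ y , p) ]′
       (λ { (inj₁ x , p) → inj₁ (x , p) ; (inj₂ y , p) → inj₂ (y , p) })
       (hasLabel? e a ⊎-dec hasLabel? f a)

hasEdge? : (e : FusionExpr k) → Decidable (HasEdge ⟦ e ⟧ᶠ)
hasEdge? (atom i m) a b = no λ ()
hasEdge? (η i j _ e) a b =
  map′ {A = HasEdge ⟦ e ⟧ᶠ a b
          ⊎ (a ≡ i × b ≡ j × HasLabel ⟦ e ⟧ᶠ i × HasLabel ⟦ e ⟧ᶠ j)
          ⊎ (a ≡ j × b ≡ i × HasLabel ⟦ e ⟧ᶠ j × HasLabel ⟦ e ⟧ᶠ i)}
       (λ { (inj₁ (x , p , y , q , xy)) → x , p , y , q , inj₁ xy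
          ; (inj₂ (inj₁ (p , q , (x , p′) , (y , q′)))) →
              x , trans p′ (sym p) , y , trans q′ (sym q) , inj₂ (inj₁ (p′ , q′))
          ; (inj₂ (inj₂ (p , q , (x , p′) , (y , q′)))) →
              x , trans p′ (sym p) , y , trans q′ (sym q) , inj₂ (inj₂ (p′ , q′)) })
       (λ { (x , p , y , q , inj₁ xy) → inj₁ (x , p , y , q , xy)
          ; (x , p , y , q , inj₂ (inj₁ (p′ , q′))) →
              inj₂ (inj₁ (trans (sym p) p′ , trans (sym q) q′ , (x , p′) , (y , q′)))
          ; (x , p , y , q , inj₂ (inj₂ (p′ , q′))) →
              inj₂ (inj₂ (trans (sym p) p′ , trans (sym q) q′ , (x , p′) , (y , q′))) })
       (hasEdge? e a b
         ⊎-dec (a ≟ i ×-dec b ≟ j ×-dec hasLabel? e i ×-dec hasLabel? e j)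
         ⊎-dec (a ≟ j ×-dec b ≟ i ×-dec hasLabel? e j ×-dec hasLabel? e i))
hasEdge? (ρ i j e) a b =
  map′ (λ { (_ , a′↦a , _ , b′↦b , x , refl , y , refl , xy) → x , a′↦a , y , b′↦b , xy })
       (λ { (x , x↦a , y , y↦b , xy) → _ , x↦a , _ , y↦b , x , refl , y , refl , xy })
       (any? λ a′ → replace i j a′ ≟ a ×-dec any? λ b′ → replace i j b′ ≟ b ×-dec hasEdge? e a′ b′)
-- Outside class `i` the occurring edges persist by `keptNbr`, and those from `i` to another label
-- persist by `mergedNbr`. Between `i` and itself none are left, since the merged vertex is the only
-- one labeled `i` and has no loop.
hasEdge? (θ i e) a b with a ≟ i | b ≟ i
... | no a≢i   | _       =
  map′ (λ { (x , refl , nbr) → kept x a≢i , refl , ⇒ keptNbr nbr })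
       (λ { (kept x _ , x≡a , nbr) → x , x≡a , ⇐ keptNbr nbr
          ; (merged _ , i≡a , _) → contradiction (sym i≡a) a≢i })
       (hasEdge? e a b)
... | yes refl | no b≢i  =
  map′ (λ { edge@(x , x≡i , _) → merged (x , x≡i) , refl , ⇒ (mergedNbr b≢i) edge })
       (λ { (kept x x≢i , x≡i , _) → ⊥-elim-irr (x≢i x≡i)
          ; (merged _ , _ , nbr) → ⇐ (mergedNbr b≢i) nbr })
       (hasEdge? e a b)
... | yes refl | yes refl = no
  λ { (kept x x≢i , x≡i , _) → ⊥-elim-irr (x≢i x≡i)
    ; (merged _ , _ , kept y y≢i , y≡i , _) → ⊥-elim-irr (y≢i y≡i)
    ; (merged _ , _ , merged _ , _ , ()) }
hasEdge? (e ⊕ f) a b =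
  map′ [ (λ (x , p , y , q , xy) → inj₁ x , p , inj₁ y , q , Pointwise.inj₁ xy)
       , (λ (x , p , y , q , xy) → inj₂ x , p , inj₂ y , q , Pointwise.inj₂ xy) ]′
       (λ { (inj₁ x , p , inj₁ y , q , Pointwise.inj₁ xy) → inj₁ (x , p , y , q , xy)
          ; (inj₂ x , p , inj₂ y , q , Pointwise.inj₂ xy) → inj₂ (x , p , y , q , xy) })
       (hasEdge? e a b ⊎-dec hasEdge? f a b)

-- Coding a label together with a set of labels.

-- A label of the clique expression codes a pair of a label and a set of labels,
-- the set through its characteristic function.
codes : ℕ → ℕ
codes k = k * 2 ^ k

label : Fin (codes k) → Fin k
label {k} l = proj₁ (remQuot {k} (2 ^ k) l)

infix 4 _∋_ _∋?_

_∋_ : Fin (codes k) → Pred (Fin k) 0ℓ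
_∋_ {k} l j = finToFun (proj₂ (remQuot {k} (2 ^ k) l)) j ≡ suc zero

_∋?_ : (l : Fin (codes k)) (j : Fin k) → Dec (l ∋ j)
_∋?_ {k} l j = finToFun (proj₂ (remQuot {k} (2 ^ k) l)) j ≟ suc zero

indicator : {A : Set} → Dec A → Fin 2
indicator A? = if does A? then suc zero else zero

indicator⇔ : {A : Set} (A? : Dec A) → A ⇔ (indicator A? ≡ suc zero)
indicator⇔ (yes a) = mk⇔ (λ _ → refl) (λ _ → a)
indicator⇔ (no ¬a) = mk⇔ (λ a → contradiction a ¬a) (λ ())

indicator-cong : {A B : Set} (A? : Dec A) (B? : Dec B) → A ⇔ B → indicator A? ≡ indicator B?
indicator-cong (yes _) (yes _) _   = refl
indicator-cong (no _)  (no _)  _   = refl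
indicator-cong (yes a) (no ¬b) A⇔B = contradiction (⇒ A⇔B a) ¬b
indicator-cong (no ¬a) (yes b) A⇔B = contradiction (⇐ A⇔B b) ¬a

funToFin-cong : ∀ {m n} {f g : Fin m → Fin n} → (∀ i → f i ≡ g i) → funToFin f ≡ funToFin g
funToFin-cong {zero}  f≗g = refl
funToFin-cong {suc m} f≗g = cong₂ combine (f≗g zero) (funToFin-cong (f≗g ∘ suc))

encode : Fin k → {S : Pred (Fin k) 0ℓ} → Unary.Decidable S → Fin (codes k)
encode i S? = combine i (funToFin (indicator ∘ S?))

module _ {k : ℕ} (i : Fin k) {S : Pred (Fin k) 0ℓ} (S? : Unary.Decidable S) where

  label-encode : label (encode i S?) ≡ i
  label-encode = cong proj₁ (remQuot-combine i _)

  ∋-encode : ∀ j → (encode i S? ∋ j) ⇔ S j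
  ∋-encode j = mk⇔ (λ e → ⇐ (indicator⇔ (S? j)) (trans (sym bit) e))
                   (λ s → trans bit (⇒ (indicator⇔ (S? j)) s))
    where
    bit : finToFun (proj₂ (remQuot {k} (2 ^ k) (encode i S?))) j ≡ indicator (S? j)
    bit = trans (cong (λ p → finToFun (proj₂ p) j) (remQuot-combine {k} i _))
                (finToFun-funToFin (indicator ∘ S?) j)

-- Codes are numbers, so sets with the same elements get the same code, whatever their decision
-- procedures. The idempotence proofs for the label maps rest on this.
encode-cong : {i j : Fin k} {S T : Pred (Fin k) 0ℓ} {S? : Unary.Decidable S} {T? : Unary.Decidable T} →
              i ≡ j → (∀ a → S a ⇔ T a) → encode i S? ≡ encode j T?
encode-cong {S? = S?} {T?} i≡j S⇔T = cong₂ combine i≡j (funToFin-cong λ a → indicator-cong (S? a) (T? a) (S⇔T a))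

-- The invariant of the translation: `D` is the set of doomed labels, and `to` and `from` match the
-- vertices of `H` with those of `G` that are not doomed. `nbrs` constrains the recorded set on
-- doomed labels only, so when a label stops being doomed its bit may stay as it is.
record Encodes (D : Pred (Fin k) 0ℓ) (G : LabeledGraph k) (H : LabeledGraph (codes k)) : Set where
  field
    to       : V H → V G
    survives : ∀ x → ¬ D (lab G (to x))
    from     : ∀ y → ¬ D (lab G y) → V H
    to-from  : ∀ y p → to (from y p) ≡ y
    from-to  : ∀ x p → from (to x) p ≡ x
    adj      : ∀ x y → Adj H x y ⇔ Adj G (to x) (to y)
    labels   : ∀ x → label (lab H x) ≡ lab G (to x)
    nbrs     : ∀ x j → D j → (lab H x ∋ j) ⇔ HasNbr G (to x) j

Encoded : Pred (Fin k) 0ℓ → LabeledGraph k → Set₁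
Encoded {k} D G = ∃ λ (H : LabeledGraph (codes k)) → Constructible H × Encodes D G H

∅? : Unary.Decidable {A = Fin k} Unary.∅
∅? _ = no id

-- Preservation of the invariant by each operation.

module _ {k : ℕ} {D : Pred (Fin k) 0ℓ} where

  isolated-encoded : Unary.Decidable D → ∀ i m → Encoded D (isolated i (suc m))
  isolated-encoded D? i m with D? i
  -- All vertices of the atom share the doomed label, so none is created: the graph on zero vertices
  -- represents them.
  ... | yes d = isolated (encode i ∅?) 0 , inj₁ (λ ()) , record
    { to       = λ ()
    ; survives = λ ()
    ; from     = λ _ ¬d → contradiction d ¬d
    ; to-from  = λ _ ¬d → contradiction d ¬d
    ; from-to  = λ ()
    ; adj      = λ ()
    ; labels   = λ ()
    ; nbrs     = λ ()
    }
  ... | no ¬d = isolated (encode i ∅?) (suc m) , inj₂ (isolated-built _ m) , record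
    { to       = id
    ; survives = λ _ → ¬d
    ; from     = λ y _ → y
    ; to-from  = λ _ _ → refl
    ; from-to  = λ _ _ → refl
    ; adj      = λ _ _ → ⇔-id _
    ; labels   = λ _ → label-encode i ∅?
    ; nbrs     = λ _ j _ → mk⇔ (λ l∋j → ⊥-elim (⇒ (∋-encode i ∅? j) l∋j)) (λ ())
    }

  disjointUnion-encoded : ∀ {G G′} → Encoded D G → Encoded D G′ → Encoded D (disjointUnion G G′)
  disjointUnion-encoded (H , b , enc) (H′ , b′ , enc′) =
    disjointUnion H H′ , disjointUnion-constructible b b′ , record
    { to       = λ { (inj₁ x) → inj₁ (E.to x) ; (inj₂ x) → inj₂ (E′.to x) }
    ; survives = λ { (inj₁ x) → E.survives x ; (inj₂ x) → E′.survives x }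
    ; from     = λ { (inj₁ y) p → inj₁ (E.from y p) ; (inj₂ y) p → inj₂ (E′.from y p) }
    ; to-from  = λ { (inj₁ y) p → cong inj₁ (E.to-from y p) ; (inj₂ y) p → cong inj₂ (E′.to-from y p) }
    ; from-to  = λ { (inj₁ x) p → cong inj₁ (E.from-to x p) ; (inj₂ x) p → cong inj₂ (E′.from-to x p) }
    ; adj      = λ
        { (inj₁ x) (inj₁ y) → mk⇔ (λ { (Pointwise.inj₁ a) → Pointwise.inj₁ (⇒ (E.adj x y) a) })
                                  (λ { (Pointwise.inj₁ a) → Pointwise.inj₁ (⇐ (E.adj x y) a) })
        ; (inj₁ x) (inj₂ y) → mk⇔ (λ ()) (λ ())
        ; (inj₂ x) (inj₁ y) → mk⇔ (λ ()) (λ ())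
        ; (inj₂ x) (inj₂ y) → mk⇔ (λ { (Pointwise.inj₂ a) → Pointwise.inj₂ (⇒ (E′.adj x y) a) })
                                  (λ { (Pointwise.inj₂ a) → Pointwise.inj₂ (⇐ (E′.adj x y) a) }) }
    ; labels   = λ { (inj₁ x) → E.labels x ; (inj₂ x) → E′.labels x }
    ; nbrs     = λ
        { (inj₁ x) j d → mk⇔ (λ { (z , p , a) → inj₁ z , p , Pointwise.inj₁ a })
                             (λ { (inj₁ z , p , Pointwise.inj₁ a) → z , p , a }) ⇔-∘ E.nbrs x j d
        ; (inj₂ x) j d → mk⇔ (λ { (z , p , a) → inj₂ z , p , Pointwise.inj₂ a })
                             (λ { (inj₂ z , p , Pointwise.inj₂ a) → z , p , a }) ⇔-∘ E′.nbrs x j d }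
    }
    where
    module E  = Encodes enc
    module E′ = Encodes enc′

mapLabels-constructible : (h : Fin M → Fin M) → (∀ l → h (h l) ≡ h l) → {H : LabeledGraph M} →
                          Constructible H → Constructible (mapLabels h H)
mapLabels-constructible h h-idem = Sum.map₂ (mapLabels-built h h-idem)

connectBy-constructible : (Q : Rel (Fin M) 0ℓ) → Decidable Q → (∀ l → ¬ Q l l) → {H : LabeledGraph M} →
                          Constructible H → Constructible (connectBy Q H)
connectBy-constructible Q Q? Q-irrefl = Sum.map₂ (connectBy-built Q Q? Q-irrefl)

module _ {k : ℕ} {D : Pred (Fin k) 0ℓ} {G : LabeledGraph k} (i j : Fin k) where

  private
    r : Fin k → Fin k
    r = replace i j

    Moved : Fin (codes k) → Pred (Fin k) 0ℓ
    Moved l a = ∃ λ b → r b ≡ a × l ∋ b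

    moved? : ∀ l → Unary.Decidable (Moved l)
    moved? l a = any? λ b → r b ≟ a ×-dec l ∋? b

    h : Fin (codes k) → Fin (codes k)
    h l = encode (r (label l)) (moved? l)

    -- `h` takes the image of both components under `r`, and by `replace-idem` a second image
    -- changes nothing. Hence `h` can be carried out by a sequence of `ρ`.
    h-idem : ∀ l → h (h l) ≡ h l
    h-idem l = encode-cong {S? = moved? (h l)} {moved? l}
      (trans (cong r (label-encode (r (label l)) (moved? l))) (replace-idem i j (label l)))
      λ a → mk⇔
        (λ { (b , refl , hl∋b) → case-∋ b (⇒ (∋-encode (r (label l)) (moved? l) b) hl∋b) })
        (λ { (c , refl , l∋c) →
               r c , replace-idem i j c , ⇐ (∋-encode (r (label l)) (moved? l) (r c)) (c , refl , l∋c) })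
      where
      case-∋ : ∀ b → Moved l b → Moved l (r b)
      case-∋ _ (c , refl , l∋c) = c , sym (replace-idem i j c) , l∋c

  -- A label below `ρ` is doomed exactly when the label it turns into is doomed above, so the doomed
  -- set below is the preimage under `replace i j`.
  relabel-encoded : Encoded (D ∘ replace i j) G → Encoded D (relabel i j G)
  relabel-encoded (H , b , enc) = mapLabels h H , mapLabels-constructible h h-idem b , record
    { to       = to
    ; survives = survives
    ; from     = from
    ; to-from  = to-from
    ; from-to  = from-to
    ; adj      = adj
    ; labels   = λ x → trans (label-encode _ (moved? (lab H x))) (cong r (labels x))
    ; nbrs     = λ x a d → mk⇔
        (λ { (c , refl , l∋c) → let (z , p , xz) = ⇒ (nbrs x c d) l∋c in z , cong r p , xz })
        (λ { (z , refl , xz) → lab G z , refl , ⇐ (nbrs x (lab G z) d) (z , refl , xz) })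
        ⇔-∘ ∋-encode _ (moved? (lab H x)) a
    }
    where open Encodes enc

module _ {k : ℕ} {D : Pred (Fin k) 0ℓ} {G : LabeledGraph k} (i j : Fin k) (i≢j : i ≢ j)
         (hasLabelG? : Unary.Decidable (HasLabel G)) where

  private
    Q : Rel (Fin (codes k)) 0ℓ
    Q l m = label l ≡ i × label m ≡ j

    -- A vertex labeled `i` gains the neighbouring label `j` only if class `j` is inhabited, and
    -- symmetrically. This is asked of `G`, because the doomed vertices of the class are absent from
    -- `H`.
    Extended : Fin (codes k) → Pred (Fin k) 0ℓ
    Extended l a = l ∋ a ⊎ (label l ≡ i × a ≡ j × HasLabel G j) ⊎ (label l ≡ j × a ≡ i × HasLabel G i)

    extended? : ∀ l → Unary.Decidable (Extended l)
    extended? l a = l ∋? a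
      ⊎-dec (label l ≟ i ×-dec a ≟ j ×-dec hasLabelG? j)
      ⊎-dec (label l ≟ j ×-dec a ≟ i ×-dec hasLabelG? i)

    h : Fin (codes k) → Fin (codes k)
    h l = encode (label l) (extended? l)

    label-h : ∀ l → label (h l) ≡ label l
    label-h l = label-encode (label l) (extended? l)

    h-idem : ∀ l → h (h l) ≡ h l
    h-idem l = encode-cong {S? = extended? (h l)} {extended? l} (label-h l) λ a → mk⇔
      (λ { (inj₁ hl∋a) → ⇒ (∋-encode (label l) (extended? l) a) hl∋a
         ; (inj₂ (inj₁ (p , q))) → inj₂ (inj₁ (trans (sym (label-h l)) p , q))
         ; (inj₂ (inj₂ (p , q))) → inj₂ (inj₂ (trans (sym (label-h l)) p , q)) })
      (inj₁ ∘ ⇐ (∋-encode (label l) (extended? l) a))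

  -- The edges between survivors are added for all pairs of codes lying over `i` and `j`. The edges
  -- to doomed vertices appear only as an update of the recorded sets.
  connect-encoded : Encoded D G → Encoded D (connect i j G)
  connect-encoded (H , b , enc) =
    mapLabels h (connectBy Q H) ,
    mapLabels-constructible h h-idem (connectBy-constructible Q
      (λ l m → label l ≟ i ×-dec label m ≟ j) (λ { l (refl , i≡j) → i≢j i≡j }) b) ,
    record
    { to       = to
    ; survives = survives
    ; from     = from
    ; to-from  = to-from
    ; from-to  = from-to
    ; adj      = λ x y → mk⇔
        (λ { (inj₁ a) → inj₁ (⇒ (adj x y) a)
           ; (inj₂ (inj₁ (p , q))) → inj₂ (inj₁ (trans (sym (labels x)) p , trans (sym (labels y)) q))
           ; (inj₂ (inj₂ (p , q))) → inj₂ (inj₂ (trans (sym (labels x)) q , trans (sym (labels y)) p)) })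
        (λ { (inj₁ a) → inj₁ (⇐ (adj x y) a)
           ; (inj₂ (inj₁ (p , q))) → inj₂ (inj₁ (trans (labels x) p , trans (labels y) q))
           ; (inj₂ (inj₂ (p , q))) → inj₂ (inj₂ (trans (labels y) q , trans (labels x) p)) })
    ; labels   = λ x → trans (label-h (lab H x)) (labels x)
    ; nbrs     = λ x a d → mk⇔
        (λ { (inj₁ l∋a) → let (z , p , xz) = ⇒ (nbrs x a d) l∋a in z , p , inj₁ xz
           ; (inj₂ (inj₁ (p , refl , z , q))) → z , q , inj₂ (inj₁ (trans (sym (labels x)) p , q))
           ; (inj₂ (inj₂ (p , refl , z , q))) → z , q , inj₂ (inj₂ (trans (sym (labels x)) p , q)) })
        (λ { (z , p , inj₁ xz) → inj₁ (⇐ (nbrs x a d) (z , p , xz))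
           ; (z , p , inj₂ (inj₁ (q , r))) →
               inj₂ (inj₁ (trans (labels x) q , trans (sym p) r , z , r))
           ; (z , p , inj₂ (inj₂ (q , r))) →
               inj₂ (inj₂ (trans (labels x) q , trans (sym p) r , z , r)) })
        ⇔-∘ ∋-encode _ (extended? (lab H x)) a
    }
    where open Encodes enc

module _ {k : ℕ} {D : Pred (Fin k) 0ℓ} {G : LabeledGraph k} (i : Fin k) where

  private
    -- The doomed set below `θ i`: whatever carries the label `i` there is about to be merged.
    D⁺ : Pred (Fin k) 0ℓ
    D⁺ a = D a ⊎ a ≡ i

  -- No atom is added, since the merged vertex is itself doomed by a later `θ` or does not exist.
  -- The survivors are then the same before and after the merge.
  unmerged-encoded : D i ⊎ ¬ HasLabel G i → Encoded D⁺ G → Encoded D (merge i G)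
  unmerged-encoded absent (H , b , enc) = H , b , record
    { to       = λ x → kept (to x) (survives x ∘ inj₂)
    ; survives = λ x → survives x ∘ inj₁
    ; from     = λ
        { (kept y y≢i) ¬d → from y [ ¬d , (λ y≡i → ⊥-elim-irr (y≢i y≡i)) ]′
        ; (merged x∈i) ¬d → ⊥-elim-irr ([ ¬d , (λ x∉i → x∉i x∈i) ]′ absent) }
    ; to-from  = λ
        { (kept y _) _ → kept-cong (to-from y _)
        ; (merged x∈i) ¬d → ⊥-elim-irr ([ ¬d , (λ x∉i → x∉i x∈i) ]′ absent) }
    ; from-to  = λ x _ → from-to x _
    ; adj      = adj
    ; labels   = labels
    ; nbrs     = λ x j d → keptNbr ⇔-∘ nbrs x j (inj₁ d)
    }
    where open Encodes enc

  module _ (hasEdgeG? : Decidable (HasEdge G)) (G-sym : ∀ {x y} → Adj G x y → Adj G y x) where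

    private
      -- Label `i` is doomed below, so no vertex of `H` carries it and only the fresh atom matches
      -- the first condition. The second keeps the atom from being joined to itself: its recorded
      -- set contains `i` if class `i` had inner edges.
      Q : Rel (Fin (codes k)) 0ℓ
      Q l m = label l ≡ i × label m ≢ i × m ∋ i

      fresh : Fin (codes k)
      fresh = encode i (hasEdgeG? i)

      label-fresh : label fresh ≡ i
      label-fresh = label-encode i (hasEdgeG? i)

    merged-encoded : ¬ D i → HasLabel G i → Encoded D⁺ G → Encoded D (merge i G)
    merged-encoded ¬Di x∈i (H , b , enc) =
      connectBy Q (disjointUnion H (isolated fresh 1)) ,
      connectBy-constructible Q (λ l m → label l ≟ i ×-dec ¬? (label m ≟ i) ×-dec m ∋? i)
        (λ l (l≡i , l≢i , _) → l≢i l≡i)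
        (disjointUnion-constructible b (inj₂ (atom-built fresh))) ,
      record
      { to       = to⁺
      ; survives = λ { (inj₁ x) → survives x ∘ inj₁ ; (inj₂ _) → ¬Di }
      ; from     = λ
          { (kept y y≢i) ¬d → inj₁ (from y [ ¬d , (λ y≡i → ⊥-elim-irr (y≢i y≡i)) ]′)
          ; (merged _) _ → inj₂ zero }
      ; to-from  = λ { (kept y _) _ → kept-cong (to-from y _) ; (merged _) _ → refl }
      ; from-to  = λ { (inj₁ x) _ → cong inj₁ (from-to x _) ; (inj₂ zero) _ → refl }
      ; adj      = adj⁺
      ; labels   = λ { (inj₁ x) → labels x ; (inj₂ _) → label-fresh }
      ; nbrs     = λ
          { (inj₁ x) j d → keptNbr ⇔-∘ nbrs x j (inj₁ d)
          -- As `i` is no longer doomed, a doomed `j` differs from `i`, and the bit of `i` in the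
          -- fresh code is never tested.
          ; (inj₂ _) j d → mergedNbr (λ { refl → ¬Di d }) ⇔-∘ ∋-encode i (hasEdgeG? i) j }
      }
      where
      open Encodes enc

      H⁺ : LabeledGraph (codes k)
      H⁺ = connectBy Q (disjointUnion H (isolated fresh 1))

      to⁺ : V H⁺ → V (merge i G)
      to⁺ (inj₁ x) = kept (to x) (survives x ∘ inj₂)
      to⁺ (inj₂ _) = merged x∈i

      label≢i : ∀ x → label (lab H x) ≢ i
      label≢i x p = survives x (inj₂ (trans (sym (labels x)) p))

      adj⁺ : ∀ x y → Adj H⁺ x y ⇔ Adj (merge i G) (to⁺ x) (to⁺ y)
      adj⁺ (inj₁ x) (inj₁ y) = mk⇔
        (λ { (inj₁ (Pointwise.inj₁ a)) → ⇒ (adj x y) a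
           ; (inj₂ (inj₁ (p , _))) → contradiction p (label≢i x)
           ; (inj₂ (inj₂ (p , _))) → contradiction p (label≢i y) })
        (λ a → inj₁ (Pointwise.inj₁ (⇐ (adj x y) a)))
      adj⁺ (inj₁ x) (inj₂ _) = mk⇔
        (λ { (inj₁ ())
           ; (inj₂ (inj₁ (p , _))) → contradiction p (label≢i x)
           ; (inj₂ (inj₂ (_ , _ , x∋i))) → ⇒ (nbrs x i (inj₂ refl)) x∋i })
        (λ nbr → inj₂ (inj₂ (label-fresh , label≢i x , ⇐ (nbrs x i (inj₂ refl)) nbr)))
      adj⁺ (inj₂ _) (inj₁ y) = mk⇔
        (λ { (inj₁ ())
           ; (inj₂ (inj₁ (_ , _ , y∋i))) →
               let (z , z≡i , a) = ⇒ (nbrs y i (inj₂ refl)) y∋i in z , z≡i , G-sym a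
           ; (inj₂ (inj₂ (p , _))) → contradiction p (label≢i y) })
        (λ { (z , z≡i , a) →
               inj₂ (inj₁ (label-fresh , label≢i y , ⇐ (nbrs y i (inj₂ refl)) (z , z≡i , G-sym a))) })
      adj⁺ (inj₂ _) (inj₂ _) = mk⇔
        (λ { (inj₁ (Pointwise.inj₂ ()))
           ; (inj₂ (inj₁ (_ , ≢i , _))) → ≢i label-fresh
           ; (inj₂ (inj₂ (_ , ≢i , _))) → ≢i label-fresh })
        (λ ())

-- The doomed set is handed down from the root, pulled back at `ρ` and enlarged at `θ`. The
-- induction therefore runs over all decidable `D` at once.
encoded : (e : FusionExpr k) {D : Pred (Fin k) 0ℓ} → Unary.Decidable D → Encoded D ⟦ e ⟧ᶠ
encoded (atom i (suc m)) D? = isolated-encoded D? i m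
encoded (η i j i≢j e) D? = connect-encoded i j i≢j (hasLabel? e) (encoded e D?)
encoded (ρ i j e) D? = relabel-encoded i j (encoded e (D? ∘ replace i j))
encoded (θ i e) {D} D? with D? i | hasLabel? e i | encoded e {λ a → D a ⊎ a ≡ i} (λ a → D? a ⊎-dec a ≟ i)
... | yes d | _       | enc = unmerged-encoded i (inj₁ d) enc
... | no _  | no x∉i  | enc = unmerged-encoded i (inj₂ x∉i) enc
... | no ¬d | yes x∈i | enc = merged-encoded i (hasEdge? e) (Adj-sym e) ¬d x∈i enc
encoded (e ⊕ f) D? = disjointUnion-encoded (encoded e D?) (encoded f D?)

-- Comparison of the two widths.

fusion⇒clique : ∀ G → FusionGenerated G k → CliqueGenerated G (codes k)
fusion⇒clique {k} G (e , iso) with encoded e {Unary.∅} ∅?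
-- Nothing is doomed at the root, so every vertex survives. As `G` is nonempty, the empty
-- alternative is impossible.
... | H , inj₁ ¬x , enc =
  contradiction (Encodes.from enc (Inverse.from (_≅_.bij iso) vertex) id) ¬x
  where
  vertex : Fin (Graph.order G)
  vertex = fromℕ< (>-nonZero⁻¹ (Graph.order G))
... | H , inj₂ (c , c≃H) , enc = c , record
  { bij = I.bij ↔-∘ (survivors ↔-∘ C.bij)
  ; adj = λ x y → I.adj _ _ ⇔-∘ (E.adj _ _ ⇔-∘ C.adj x y)
  }
  where
  module I = _≅_ iso
  module E = Encodes enc
  module C = _≃_ c≃H
  survivors : V H ↔ V ⟦ e ⟧ᶠ
  survivors = mk↔ₛ′ E.to (λ y → E.from y id) (λ y → E.to-from y id) (λ x → E.from-to x id)

corollary2 : ∀ {ℓ : Level} (C : Pred Graph ℓ) → BoundedFusionWidth C ⇔ BoundedCliqueWidth C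
corollary2 C = mk⇔
  -- The fusion-width `m` exists only up to double negation, which suffices because the goal is a
  -- decidable inequality. Then `k ≤ codes m ≤ codes c`.
  (λ (c , fw≤c) → codes c , λ G G∈C k (_ , k-least) → decidable-stable (k ≤? codes c) λ k≰ →
    ¬¬fusionWidth G λ (m , gen , m-least) →
      k≰ (≤-trans (k-least _ (fusion⇒clique G gen)) (codes-mono (fw≤c G G∈C m (gen , m-least)))))
  -- A clique expression is a fusion-tree expression with the same labels, so the bound `c` carries
  -- over unchanged.
  (λ (c , cw≤c) → c , λ G G∈C k (_ , k-least) → decidable-stable (k ≤? c) λ k≰ →
    ¬¬cliqueWidth G λ (m , gen , m-least) →
      k≰ (≤-trans (k-least _ (clique⇒fusion G gen)) (cw≤c G G∈C m (gen , m-least))))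
  where
  codes-mono : ∀ {m n} → m ≤ n → codes m ≤ codes n
  codes-mono m≤n = *-mono-≤ m≤n (^-monoʳ-≤ 2 m≤n)

  clique⇒fusion : ∀ {k} G → CliqueGenerated G k → FusionGenerated G k
  clique⇒fusion G (e , iso) = cliqueToFusion e , subst (_≅ G) (sym (⟦cliqueToFusion⟧ e)) iso
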